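{- Let $k\ge 2$, $m\ge 0$, $1\le s\le k$, and $N=mk+s$. Each of the classes $\mathcal{D}_{N,k}(213)$ and $\mathcal{D}_{N,k}(312)$ is in explicit bijection with the set of complete ordered $k$-ary trees with $m+1$ internal vertices. Consequently, $$|\mathcal{D}_{N,k}(213)|=|\mathcal{D}_{N,k}(312)|=C^{(k)}_{m+1}.$$
   Context: For $\pi=\pi_1\cdots\pi_N\in S_N$ let $\operatorname{Des}(\pi)=\{i\in[N-1]:\pi_i>\pi_{i+1}\}$. For $k\ge2$, $N\ge1$, let $\mathcal{D}_{N,k}=\{\pi\in S_N:\operatorname{Des}(\pi)=\{k,2k,\ldots,k\lfloor (N-1)/k\rfloor\}\}$. For a pattern $p$, $\mathcal{D}_{N,k}(p)$ is the set of elements of $\mathcal{D}_{N,k}$ avoiding $p$, i.e. having no subsequence (not necessarily consecutive) in the same relative order as $p$. A complete ordered $k$-ary tree is a rooted plane tree in which every vertex is either a leaf or an internal vertex with exactly $k$ ordered children. The Fuss–Catalan number is $C^{(k)}_{m+1}=\frac{1}{(k-1)(m+1)+1}\binom{k(m+1)}{m+1}$. -}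

module Defs where

open import Data.Fin.Base as Fin using (Fin; toℕ)
open import Data.Fin.Patterns using (0F; 1F; 2F)
open import Data.Fin.Permutation using (Permutation′; permutation; _⟨$⟩ʳ_)
open import Data.Integer.Base using (+_)
open import Data.Nat.Base
  using (ℕ; suc; _+_; _*_; _∸_; _/_; _≤_; NonTrivial; nonTrivial⇒nonZero)
open import Data.Nat.Combinatorics using (_C_)
open import Data.Product.Base using (Σ-syntax; ∃-syntax; _×_; proj₁)
open import Data.Rational.Base as ℚ using (ℚ)
open import Data.Vec.Base using (Vec; []; _∷_)
open import Function.Bundles using (Inverse; _⇔_)
open import Level using (0ℓ)
open import Relation.Binary.Bundles using (Setoid)
import Relation.Binary.Construct.On as On
open import Relation.Binary.PropositionalEquality
  using (_≡_; refl; setoid; _→-setoid_)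
open import Relation.Nullary.Negation using (¬_)
open import Relation.Unary using (Pred; _≐_)

-- Positions are numbered from 1, as in [N-1]: the entry π_i is π ⟨$⟩ʳ a for
-- the a : Fin N with suc (toℕ a) ≡ i.  The existence of b forces i ≤ N-1.
Des : ∀ {N} → Permutation′ N → Pred ℕ 0ℓ
Des {N} π i = Σ[ a ∈ Fin N ] Σ[ b ∈ Fin N ]
  suc (toℕ a) ≡ i × suc (toℕ b) ≡ suc i × (π ⟨$⟩ʳ b) Fin.< (π ⟨$⟩ʳ a)

-- {k, 2k, …, k⌊(N-1)/k⌋}
Multiples : (N k : ℕ) → .{{NonTrivial k}} → Pred ℕ 0ℓ
Multiples N k i = ∃[ j ]
  1 ≤ j × j ≤ _/_ (N ∸ 1) k {{nonTrivial⇒nonZero k}} × i ≡ j * k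

-- σ picks out the positions, in increasing order, of the subsequence.
Contains : ∀ {N r} → Permutation′ N → Permutation′ r → Set
Contains {N} {r} π p = Σ[ σ ∈ (Fin r → Fin N) ]
  (∀ i j → i Fin.< j → σ i Fin.< σ j) ×
  (∀ i j → ((p ⟨$⟩ʳ i) Fin.< (p ⟨$⟩ʳ j))
             ⇔ ((π ⟨$⟩ʳ σ i) Fin.< (π ⟨$⟩ʳ σ j)))

Avoids : ∀ {N r} → Permutation′ N → Permutation′ r → Set
Avoids π p = ¬ Contains π p

pattern213 : Permutation′ 3
pattern213 = permutation
  (λ { 0F → 1F ; 1F → 0F ; 2F → 2F })
  (λ { 0F → 1F ; 1F → 0F ; 2F → 2F })
  (λ { 0F → refl ; 1F → refl ; 2F → refl })
  (λ { 0F → refl ; 1F → refl ; 2F → refl })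

pattern312 : Permutation′ 3
pattern312 = permutation
  (λ { 0F → 2F ; 1F → 0F ; 2F → 1F })
  (λ { 0F → 1F ; 1F → 2F ; 2F → 0F })
  (λ { 0F → refl ; 1F → refl ; 2F → refl })
  (λ { 0F → refl ; 1F → refl ; 2F → refl })

-- Elements are identified when the underlying permutations agree pointwise,
-- whatever the accompanying proofs.
𝒟 : (N k : ℕ) → .{{NonTrivial k}} → ∀ {r} → Permutation′ r → Setoid 0ℓ 0ℓ
𝒟 N k p = On.setoid (Fin N →-setoid Fin N) word
  where
  word : (Σ[ π ∈ Permutation′ N ] (Des π ≐ Multiples N k × Avoids π p)) →
         Fin N → Fin N
  word x = proj₁ x ⟨$⟩ʳ_

data Tree (k : ℕ) : Set where
  leaf : Tree k
  node : Vec (Tree k) k → Tree k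

mutual
  internalVertices : ∀ {k} → Tree k → ℕ
  internalVertices leaf      = 0
  internalVertices (node ts) = suc (internalVerticesOfAll ts)

  internalVerticesOfAll : ∀ {k n} → Vec (Tree k) n → ℕ
  internalVerticesOfAll []       = 0
  internalVerticesOfAll (t ∷ ts) =
    internalVertices t + internalVerticesOfAll ts

Trees : (k n : ℕ) → Setoid 0ℓ 0ℓ
Trees k n = On.setoid (setoid (Tree k)) tree
  where
  tree : (Σ[ t ∈ Tree k ] internalVertices t ≡ n) → Tree k
  tree = proj₁

HasCardinality : Setoid 0ℓ 0ℓ → ℕ → Set
HasCardinality S n = Inverse S (setoid (Fin n))

-- C^(k)_n = 1/((k-1)n+1) · binom(kn, n), kept rational so that no rounding
-- division is involved.
fussCatalan : (k n : ℕ) → ℚ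
fussCatalan k n =
  (+ 1 ℚ./ suc ((k ∸ 1) * n)) ℚ.* (+ ((k * n) C n) ℚ./ 1)

{-# OPTIONS --safe #-}
module Submission where

-- Build a permutation by appending its entries one at a time, keeping only the
-- relative order.  If a word avoids 213 or 312 and has r + 1 values that can be
-- appended without creating the pattern, then appending the largest of them is
-- an ascent, the others are descents, and after appending the d-th smallest
-- (from 0) there are d + 2 such values.  So both classes are encoded by the same
-- sequences, in which only the descents, at multiples of k, leave a choice.
-- Reading a complete k-ary tree in preorder with r subtrees still to be read,
-- one chooses which of them is the next that is not a leaf; the choices have the
-- same numbers of options, and they are counted through
-- F r (m+1) = Σ_{d<r} F (k+d) m, where F r m = r/(km+r) · binom(km+r, m).
open import Defs
open import Data.Bool.Base using (Bool; true; false)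
open import Data.Fin.Base as Fin using (Fin; toℕ; fromℕ<)
open import Data.Fin.Patterns using (0F; 1F; 2F)
open import Data.Fin.Permutation
  using (Permutation′; permutation; _⟨$⟩ʳ_; _⟨$⟩ˡ_; inverseˡ; inverseʳ)
import Data.Fin.Properties as Fin
open import Data.Fin.Properties
  using (toℕ-injective; toℕ<n; toℕ-fromℕ<; +↔⊎; 1↔⊤)
open import Data.Integer.Base using (+_)
import Data.Integer.Base as ℤ
import Data.Integer.Properties as ℤ
import Data.Nat.Base as ℕ
open import Data.Nat.Base
  using (ℕ; zero; suc; pred; _+_; _*_; _≤_; _<_; z≤n; s≤s; _≡ᵇ_; _%_; NonZero;
         ≢-nonZero⁻¹; NonTrivial; nonTrivial⇒nonZero)
open import Data.Nat.Combinatorics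
  using (_C_; nC1≡n; k>n⇒nCk≡0; nCk+nC[k+1]≡[n+1]C[k+1])
open import Data.Nat.Divisibility using (_∣_; divides; m%n≡0⇒n∣m)
open import Data.Nat.DivMod
  using (m*n%n≡0; m/n*n≤m; 0/n≡0; m*n/n≡m; /-monoˡ-≤)
open import Data.Nat.Properties
open import Data.Nat.Tactic.RingSolver using (solve-∀)
open import Data.Product.Base
  using (Σ-syntax; ∃-syntax; _×_; _,_; proj₁; proj₂; map)
open import Data.Rational.Base using (_/_)
import Data.Rational.Base as ℚ
import Data.Rational.Properties as ℚ
import Data.Rational.Unnormalised.Base as ℚᵘ
import Data.Rational.Unnormalised.Properties as ℚᵘ
open import Data.Sum.Base using (_⊎_; inj₁; inj₂)
open import Data.Sum.Function.Propositional using (_⊎-↔_)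
open import Data.Unit.Base using (⊤; tt)
open import Data.Vec.Base using (Vec; []; _∷_; _++_; take; drop)
open import Data.Vec.Properties using (take++drop≡id; ++-injective)
open import Function.Base using (_∘_)
open import Function.Bundles
  using (Inverse; Equivalence; _⇔_; mk⇔; _↔_; mk↔ₛ′)
import Function.Construct.Composition as Composition
import Function.Construct.Symmetry as Symmetry
open import Function.Properties.Inverse using (↔-sym; ↔-trans)
open import Relation.Binary.Definitions using (tri<; tri≈; tri>)
open import Relation.Binary.PropositionalEquality
open import Relation.Nullary using (¬_; Dec; yes; no; contradiction)
open import Relation.Unary using (_≐_)

-- Inserting and deleting a relative value

-- The ℕ-valued analogues of punchIn and punchOut.
shift : ℕ → ℕ → ℕ
shift zero    x       = suc x
shift (suc v) zero    = zero
shift (suc v) (suc x) = suc (shift v x)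

unshift : ℕ → ℕ → ℕ
unshift zero    x       = pred x
unshift (suc v) zero    = zero
unshift (suc v) (suc x) = suc (unshift v x)

-- `v` is the one value that `shift v` skips; there `unshift v` has only a default value.
shift-unshift : ∀ v x → x ≢ v → shift v (unshift v x) ≡ x
shift-unshift zero    zero    x≢v = contradiction refl x≢v
shift-unshift zero    (suc x) x≢v = refl
shift-unshift (suc v) zero    x≢v = refl
shift-unshift (suc v) (suc x) x≢v = cong suc (shift-unshift v x (x≢v ∘ cong suc))

shift-≢ : ∀ v x → shift v x ≢ v
shift-≢ (suc v) (suc x) eq = shift-≢ v x (suc-injective eq)

shift-below : ∀ {v x} → x < v → shift v x ≡ x
shift-below {suc v} {zero}  _         = refl
shift-below {suc v} {suc x} (s≤s x<v) = cong suc (shift-below x<v)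

shift-above : ∀ {v x} → v ≤ x → shift v x ≡ suc x
shift-above z≤n       = refl
shift-above (s≤s v≤x) = cong suc (shift-above v≤x)

shift-mono : ∀ v {x y} → x < y → shift v x < shift v y
shift-mono zero    {x}     {y}     x<y       = s≤s x<y
shift-mono (suc v) {zero}  {suc y} x<y       = s≤s z≤n
shift-mono (suc v) {suc x} {suc y} (s≤s x<y) = s≤s (shift-mono v x<y)

shift-reflect : ∀ v {x y} → shift v x < shift v y → x < y
shift-reflect v {x} {y} lt with <-cmp x y
... | tri< x<y _ _  = x<y
... | tri≈ _ refl _ = contradiction lt (<-irrefl refl)
... | tri> _ _ y<x  = contradiction lt (<-asym (shift-mono v y<x))

shift-injective : ∀ v {x y} → shift v x ≡ shift v y → x ≡ y
shift-injective v {x} {y} eq with <-cmp x y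
... | tri< x<y _ _ = contradiction eq (<⇒≢ (shift-mono v x<y))
... | tri≈ _ x≡y _ = x≡y
... | tri> _ _ y<x = contradiction (sym eq) (<⇒≢ (shift-mono v y<x))

shift<⁺ : ∀ {v x} → x < v → shift v x < v
shift<⁺ x<v = subst (_< _) (sym (shift-below x<v)) x<v

shift<⁻ : ∀ {v x} → shift v x < v → x < v
shift<⁻ {v} {x} lt with x <? v
... | yes x<v = x<v
... | no  x≮v = contradiction (<-trans (n<1+n x) (subst (_< v) (shift-above (≮⇒≥ x≮v)) lt)) x≮v

<shift⁺ : ∀ {v x} → v ≤ x → v < shift v x
<shift⁺ v≤x = subst (_ <_) (sym (shift-above v≤x)) (s≤s v≤x)

<shift⁻ : ∀ {v x} → v < shift v x → v ≤ x
<shift⁻ {v} {x} lt with x <? v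
... | yes x<v = contradiction (shift<⁺ x<v) (<-asym lt)
... | no  x≮v = ≮⇒≥ x≮v

shift-bounded : ∀ {v x n} → v ≤ n → x < n → shift v x < suc n
shift-bounded {v} {x} v≤n x<n with x <? v
... | yes x<v = subst (_< _) (sym (shift-below x<v)) (m<n⇒m<1+n x<n)
... | no  x≮v = subst (_< _) (sym (shift-above (≮⇒≥ x≮v))) (s≤s x<n)

≤shift : ∀ v x → x ≤ shift v x
≤shift v x with x <? v
... | yes x<v = ≤-reflexive (sym (shift-below x<v))
... | no  x≮v = subst (x ≤_) (sym (shift-above (≮⇒≥ x≮v))) (n≤1+n x)

unshift-bounded : ∀ {v x n} → v ≤ n → x < suc n → x ≢ v → unshift v x < n
unshift-bounded {v} {x} {n} v≤n x<1+n x≢v with unshift v x <? n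
... | yes lt = lt
-- A result of at least `n` is not below `v`, so `shift v` would raise it by one, to an `x` above
-- `n`.
... | no  ≮n = contradiction x<1+n (≤⇒≯ (begin
  suc n                  ≤⟨ s≤s (≮⇒≥ ≮n) ⟩
  suc (unshift v x)      ≡⟨ shift-above (≤-trans v≤n (≮⇒≥ ≮n)) ⟨
  shift v (unshift v x)  ≡⟨ shift-unshift v x x≢v ⟩
  x                      ∎))
  where open ≤-Reasoning

-- Words, permutations and the last entry

-- A word of length n is a function on ℕ of which only the values at
-- 0, …, n-1 matter; snoc n w v appends the relative value v.
Word : Set
Word = ℕ → ℕ

_≗[_]_ : Word → ℕ → Word → Set
w ≗[ n ] w′ = ∀ {i} → i < n → w i ≡ w′ i

snoc : ℕ → Word → ℕ → Word
snoc n w v i with i <? n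
... | yes _ = shift v (w i)
-- All positions from `n` on receive `v`, but only position `n` belongs to the new word.
... | no  _ = v

snoc-init : ∀ n w v {i} → i < n → snoc n w v i ≡ shift v (w i)
snoc-init n w v {i} i<n with i <? n
... | yes _   = refl
... | no  i≮n = contradiction i<n i≮n

snoc-last : ∀ n w v → snoc n w v n ≡ v
snoc-last n w v with n <? n
... | yes n<n = contradiction n<n (<-irrefl refl)
... | no  _   = refl

-- `surjective` locates a given value: it yields the inverse in `toPermutation`, and the arguments
-- on appendable values use it to find the largest value or the value `r`.
record IsPermutation (n : ℕ) (w : Word) : Set where
  field
    bounded    : ∀ {i} → i < n → w i < n
    injective  : ∀ {i j} → i < n → j < n → w i ≡ w j → i ≡ j
    surjective : ∀ {v} → v < n → ∃[ i ] i < n × w i ≡ v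

open IsPermutation

<suc-split : ∀ {i n} → i < suc n → i < n ⊎ i ≡ n
<suc-split i<1+n = m≤n⇒m<n∨m≡n (≤-pred i<1+n)

snoc-isPermutation : ∀ {n w v} → v ≤ n → IsPermutation n w →
                     IsPermutation (suc n) (snoc n w v)
snoc-isPermutation {n} {w} {v} v≤n p = record
  { bounded = bd ; injective = inj ; surjective = sur }
  where
  w′ = snoc n w v
  bd : ∀ {i} → i < suc n → w′ i < suc n
  bd i<1+n with <suc-split i<1+n
  ... | inj₁ i<n  = subst (_< suc n) (sym (snoc-init n w v i<n)) (shift-bounded v≤n (bounded p i<n))
  ... | inj₂ refl = subst (_< suc n) (sym (snoc-last n w v)) (s≤s v≤n)

  inj : ∀ {i j} → i < suc n → j < suc n → w′ i ≡ w′ j → i ≡ j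
  inj i<1+n j<1+n eq with <suc-split i<1+n | <suc-split j<1+n
  ... | inj₁ i<n  | inj₁ j<n  = injective p i<n j<n
    (shift-injective v (trans (sym (snoc-init n w v i<n)) (trans eq (snoc-init n w v j<n))))
  ... | inj₁ i<n  | inj₂ refl =
    contradiction (trans (sym (snoc-init n w v i<n)) (trans eq (snoc-last n w v))) (shift-≢ v _)
  ... | inj₂ refl | inj₁ j<n  =
    contradiction (trans (sym (snoc-init n w v j<n)) (trans (sym eq) (snoc-last n w v))) (shift-≢ v _)
  ... | inj₂ refl | inj₂ refl = refl

  sur : ∀ {u} → u < suc n → ∃[ i ] i < suc n × w′ i ≡ u
  sur {u} u<1+n with u ≟ v
  ... | yes refl = n , n<1+n n , snoc-last n w v
  ... | no  u≢v  with surjective p (unshift-bounded v≤n u<1+n u≢v)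
  ...   | i , i<n , eq = i , m<n⇒m<1+n i<n ,
    trans (snoc-init n w v i<n) (trans (cong (shift v) eq) (shift-unshift v u u≢v))

init : ℕ → Word → Word
init n w i = unshift (w n) (w i)

module _ {n : ℕ} {w : Word} (p : IsPermutation (suc n) w) where

  last-≤ : w n ≤ n
  last-≤ = ≤-pred (bounded p (n<1+n n))

  init-≢ : ∀ {i} → i < n → w i ≢ w n
  init-≢ i<n eq = <⇒≢ i<n (injective p (m<n⇒m<1+n i<n) (n<1+n n) eq)

  shift-init : ∀ {i} → i < n → shift (w n) (init n w i) ≡ w i
  shift-init i<n = shift-unshift (w n) _ (init-≢ i<n)

  init-isPermutation : IsPermutation n (init n w)
  init-isPermutation = record
    { bounded    = λ i<n → unshift-bounded last-≤ (bounded p (m<n⇒m<1+n i<n)) (init-≢ i<n)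
    ; injective  = λ i<n j<n eq → injective p (m<n⇒m<1+n i<n) (m<n⇒m<1+n j<n)
        (trans (sym (shift-init i<n)) (trans (cong (shift (w n)) eq) (shift-init j<n)))
    ; surjective = sur
    }
    where
    sur : ∀ {v} → v < n → ∃[ i ] i < n × init n w i ≡ v
    sur {v} v<n with surjective p (shift-bounded last-≤ v<n)
    ... | i , i<1+n , eq with <suc-split i<1+n
    ...   | inj₂ refl = contradiction (sym eq) (shift-≢ (w n) v)
    ...   | inj₁ i<n  = i , i<n , shift-injective (w n) (trans (shift-init i<n) eq)

-- Prescribed descents and occurrences of patterns

Direction : Bool → ℕ → ℕ → Set
Direction true  x y = y < x
Direction false x y = x < y

-- Entries are numbered from 0 and descent positions from 1, so `P (suc i)` governs the entries `i`
-- and `suc i`.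
Follows : (ℕ → Bool) → ℕ → Word → Set
Follows P n w = ∀ {i} → suc i < n → Direction (P (suc i)) (w i) (w (suc i))

direction-shift : ∀ b v {x y} → Direction b x y → Direction b (shift v x) (shift v y)
direction-shift true  v = shift-mono v
direction-shift false v = shift-mono v

direction-unshift : ∀ b v {x y} → Direction b (shift v x) (shift v y) → Direction b x y
direction-unshift true  v = shift-reflect v
direction-unshift false v = shift-reflect v

Pattern : Set₁
Pattern = ℕ → ℕ → ℕ → Set

-- This is how a pattern depends on relative order only: appending a value neither creates nor
-- destroys occurrences among the old entries.
ShiftInvariant : Pattern → Set
ShiftInvariant R = ∀ v {x y z} → (R x y z → R (shift v x) (shift v y) (shift v z)) ×
                                 (R (shift v x) (shift v y) (shift v z) → R x y z)

Occurs : Pattern → ℕ → Word → Set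
Occurs R n w = ∃[ i ] ∃[ j ] ∃[ l ] i < j × j < l × l < n × R (w i) (w j) (w l)

OccursAtEnd : Pattern → ℕ → Word → ℕ → Set
OccursAtEnd R n w v = ∃[ i ] ∃[ j ] i < j × j < n × R (shift v (w i)) (shift v (w j)) v

transport₃ : ∀ (R : Pattern) {x y z x′ y′ z′} → x ≡ x′ → y ≡ y′ → z ≡ z′ → R x y z → R x′ y′ z′
transport₃ R refl refl refl r = r

module _ (R : Pattern) (R-shift : ShiftInvariant R) where

  occurs-snoc⁻ : ∀ {n w v} → Occurs R (suc n) (snoc n w v) → Occurs R n w ⊎ OccursAtEnd R n w v
  occurs-snoc⁻ {n} {w} {v} (i , j , l , i<j , j<l , l<1+n , r) with <suc-split l<1+n
  ... | inj₁ l<n  = inj₁ (i , j , l , i<j , j<l , l<n , proj₂ (R-shift v) (transport₃ R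
    (snoc-init n w v (<-trans i<j (<-trans j<l l<n))) (snoc-init n w v (<-trans j<l l<n))
    (snoc-init n w v l<n) r))
  ... | inj₂ refl = inj₂ (i , j , i<j , j<l , transport₃ R
    (snoc-init n w v (<-trans i<j j<l)) (snoc-init n w v j<l) (snoc-last n w v) r)

  occurs-init : ∀ {n w} → IsPermutation (suc n) w → Occurs R n (init n w) → Occurs R (suc n) w
  occurs-init {n} {w} p (i , j , l , i<j , j<l , l<n , r) =
    i , j , l , i<j , j<l , m<n⇒m<1+n l<n , transport₃ R
      (shift-init p (<-trans i<j (<-trans j<l l<n))) (shift-init p (<-trans j<l l<n))
      (shift-init p l<n) (proj₁ (R-shift (w n)) r)

  -- In `word-surjective` the shorter word is the word of a code, known to agree with `init n w`
  -- only below `n`; hence the separate `w₀`.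
  occursAtEnd-init : ∀ {n w w₀} → IsPermutation (suc n) w → w₀ ≗[ n ] init n w →
                     OccursAtEnd R n w₀ (w n) → Occurs R (suc n) w
  occursAtEnd-init {n} {w} p eq (i , j , i<j , j<n , r) =
    i , j , n , i<j , j<n , n<1+n n , transport₃ R
      (trans (cong (shift (w n)) (eq (<-trans i<j j<n))) (shift-init p (<-trans i<j j<n)))
      (trans (cong (shift (w n)) (eq j<n)) (shift-init p j<n)) refl r

-- Codes and the words they generate

Choice : Bool → ℕ → ℕ → Set
Choice true  r d = d < r
Choice false r d = d ≡ r

choice-≤ : ∀ b {r d} → Choice b r d → d ≤ r
choice-≤ true  = <⇒≤
choice-≤ false = ≤-reflexive

choice-irrelevant : ∀ b {r d} (p q : Choice b r d) → p ≡ q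
choice-irrelevant true  = ≤-irrelevant
choice-irrelevant false = ≡-irrelevant

-- A code of a pattern-avoiding word of length n whose descents are given by P.
-- The values that may be appended next are listed in increasing order as
-- sites 0, …, r; only site r is an ascent, and after appending the value at
-- site d there are sites 0, …, d + 1.
data Code (P : ℕ → Bool) : ℕ → ℕ → Set where
  []   : Code P 0 0
  step : ∀ {n r} → Code P n r → (d : ℕ) → Choice (P n) r d → Code P (suc n) (suc d)

-- The value at a site may depend on the whole code, as it does for 312.
Sites : (ℕ → Bool) → Set
Sites P = ∀ {n r} → Code P n r → ℕ → ℕ

word : ∀ {P} → Sites P → ∀ {n r} → Code P n r → Word
word site []                 = λ _ → 0
word site (step {n} c d _) = snoc n (word site c) (site c d)

Bounded : ∀ {P} → Sites P → Set
Bounded {P} site = ∀ {n r} (c : Code P n r) {d} → d ≤ r → site c d ≤ n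

word-isPermutation : ∀ {P} {site : Sites P} → Bounded site →
                     ∀ {n r} (c : Code P n r) → IsPermutation n (word site c)
word-isPermutation b [] = record { bounded = λ () ; injective = λ () ; surjective = λ () }
word-isPermutation {P} b (step {n} c d ch) =
  snoc-isPermutation (b c (choice-≤ (P n) ch)) (word-isPermutation b c)

-- All that distinguishes the two patterns: the sites list without repetition exactly the values
-- that keep the word free of `R`, and site `r` is the only ascent among them.
record Generates (P : ℕ → Bool) (R : Pattern) (site : Sites P) : Set where
  field
    site-≤         : Bounded site
    site-injective : ∀ {n r} (c : Code P n r) {d e} → d ≤ r → e ≤ r → site c d ≡ site c e → d ≡ e
    -- Appending `v` raises a last entry equal to `v` above it, so a descent means `≤` here and an
    -- ascent `<` in the next field.
    site-descent   : ∀ {n r} (c : Code P (suc n) r) {d} → d < r → site c d ≤ word site c n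
    site-ascent    : ∀ {n r} (c : Code P (suc n) r) → word site c n < site c r
    sound          : ∀ {n r} (c : Code P n r) {d} → d ≤ r →
                     ¬ Occurs R n (word site c) → ¬ OccursAtEnd R n (word site c) (site c d)
    complete       : ∀ {n r} (c : Code P n r) {v} → v ≤ n →
                     ¬ OccursAtEnd R n (word site c) v → ∃[ d ] d ≤ r × v ≡ site c d

module Generation {P : ℕ → Bool} (P0 : P 0 ≡ false) {R : Pattern} (R-shift : ShiftInvariant R)
                  {site : Sites P} (G : Generates P R site) where
  open Generates G

  word-avoids : ∀ {n r} (c : Code P n r) → ¬ Occurs R n (word site c)
  word-avoids [] (_ , _ , _ , _ , _ , () , _)
  word-avoids (step {n} c d ch) o with occurs-snoc⁻ R R-shift o
  ... | inj₁ o′ = word-avoids c o′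
  ... | inj₂ o′ = sound c (choice-≤ (P n) ch) (word-avoids c) o′

  choice⇒direction : ∀ {n r} (c : Code P (suc n) r) b {d} → Choice b r d →
                     Direction b (shift (site c d) (word site c n)) (site c d)
  choice⇒direction c true  d<r  = <shift⁺ (site-descent c d<r)
  choice⇒direction c false refl = shift<⁺ (site-ascent c)

  direction⇒choice : ∀ {n r} (c : Code P (suc n) r) b {d} → d ≤ r →
                     Direction b (shift (site c d) (word site c n)) (site c d) → Choice b r d
  direction⇒choice c b d≤r dir with m≤n⇒m<n∨m≡n d≤r
  direction⇒choice c true  d≤r dir | inj₁ d<r  = d<r
  direction⇒choice c true  d≤r dir | inj₂ refl =
    contradiction (<shift⁻ dir) (<⇒≱ (site-ascent c))
  direction⇒choice c false d≤r dir | inj₁ d<r  =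
    contradiction (shift<⁻ dir) (≤⇒≯ (site-descent c d<r))
  direction⇒choice c false d≤r dir | inj₂ d≡r  = d≡r

  word-follows : ∀ {n r} (c : Code P n r) → Follows P n (word site c)
  word-follows (step {n} c d ch) {i} (s≤s i<n) with m≤n⇒m<n∨m≡n i<n
  ... | inj₁ 1+i<n = subst₂ (Direction (P (suc i)))
    (sym (snoc-init n (word site c) _ i<n)) (sym (snoc-init n (word site c) _ 1+i<n))
    (direction-shift (P (suc i)) (site c d) (word-follows c 1+i<n))
  ... | inj₂ refl  = subst₂ (Direction (P n))
    (sym (snoc-init n (word site c) _ i<n)) (sym (snoc-last n (word site c) _))
    (choice⇒direction c (P n) ch)

  word-injective : ∀ {n r r′} (c : Code P n r) (c′ : Code P n r′) → word site c ≗[ n ] word site c′ →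
                   (r , c) ≡ (r′ , c′)
  word-injective [] [] eq = refl
  word-injective {suc n} (step c d ch) (step c′ d′ ch′) eq
    -- The last entry reveals the appended value; undoing the shift by it leaves equal shorter words
    -- for the recursion.
    with v≡v′ ← trans (sym (snoc-last n (word site c) _))
                  (trans (eq (n<1+n n)) (snoc-last n (word site c′) _))
    with word-injective c c′ (λ {i} i<n → shift-injective (site c d)
           (trans (sym (snoc-init n (word site c) _ i<n)) (trans (eq (m<n⇒m<1+n i<n))
             (trans (snoc-init n (word site c′) _ i<n)
               (cong (λ v → shift v (word site c′ i)) (sym v≡v′))))))
  ... | refl with site-injective c (choice-≤ (P n) ch) (choice-≤ (P n) ch′) v≡v′
  ...   | refl = cong (λ z → _ , step c d z) (choice-irrelevant (P n) ch ch′)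

  -- Deleting the last entry and standardising stays in the class, so a code of the shorter word
  -- exists; `complete` makes the last value one of its sites, and its direction decides the choice.
  word-surjective : ∀ n w → IsPermutation n w → Follows P n w → ¬ Occurs R n w →
                    ∃[ r ] Σ[ c ∈ Code P n r ] word site c ≗[ n ] w
  word-surjective zero    w p f a = 0 , [] , λ ()
  word-surjective (suc n) w p f a
    with word-surjective n (init n w) (init-isPermutation p)
           (λ {i} 1+i<n → direction-unshift (P (suc i)) (w n) (subst₂ (Direction (P (suc i)))
             (sym (shift-init p (<⇒≤ 1+i<n))) (sym (shift-init p 1+i<n)) (f (m<n⇒m<1+n 1+i<n))))
           (a ∘ occurs-init R R-shift p)
  ... | r , c , eq
    with complete c (last-≤ p) (a ∘ occursAtEnd-init R R-shift p eq)
  ...   | d , d≤r , wn≡ = suc d , step c d (choice c d≤r turn) , agree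
    where
    choice : ∀ {n r} (c : Code P n r) → d ≤ r →
             (∀ {n′} → n ≡ suc n′ → Direction (P n) (shift (site c d) (word site c n′)) (site c d)) →
             Choice (P n) r d
    -- With no last entry to compare with, it is `P0` that makes site 0 the choice.
    choice []                 d≤0 _   = subst (λ b → Choice b 0 d) (sym P0) (n≤0⇒n≡0 d≤0)
    choice c@(step {n} _ _ _) d≤r dir = direction⇒choice c (P (suc n)) d≤r (dir refl)

    turn : ∀ {n′} → n ≡ suc n′ → Direction (P n) (shift (site c d) (word site c n′)) (site c d)
    turn refl = subst₂ (Direction (P n))
      (sym (trans (cong₂ shift (sym wn≡) (eq (n<1+n _))) (shift-init p (n<1+n _)))) wn≡ (f (n<1+n n))

    agree : snoc n (word site c) (site c d) ≗[ suc n ] w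
    agree i<1+n with <suc-split i<1+n
    ... | inj₁ i<n  = trans (snoc-init n (word site c) _ i<n)
      (trans (cong₂ shift (sym wn≡) (eq i<n)) (shift-init p i<n))
    ... | inj₂ refl = trans (snoc-last n (word site c) _) (sym wn≡)

-- Appendable values for the two patterns

R213 : Pattern
R213 x y z = y < x × x < z

R312 : Pattern
R312 x y z = y < z × z < x

R213-shift : ShiftInvariant R213
R213-shift v = map (shift-mono v) (shift-mono v) , map (shift-reflect v) (shift-reflect v)

R312-shift : ShiftInvariant R312
R312-shift v = map (shift-mono v) (shift-mono v) , map (shift-reflect v) (shift-reflect v)

module _ {P : ℕ → Bool} where

  -- For 213 the appendable values are those up to one more than the last entry, an initial
  -- interval, so each site is its own value.
  site213 : Sites P
  site213 _ d = d

  r≡1+last : ∀ {n r} (c : Code P (suc n) r) → r ≡ suc (word site213 c n)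
  r≡1+last (step {n} c d _) = cong suc (sym (snoc-last n (word site213 c) d))

  r≤n : ∀ {n r} → Code P n r → r ≤ n
  r≤n []                = z≤n
  r≤n (step {n} c d ch) = s≤s (≤-trans (choice-≤ (P n) ch) (r≤n c))

  permutation213 : ∀ {n r} (c : Code P n r) → IsPermutation n (word site213 c)
  permutation213 = word-isPermutation (λ c d≤r → ≤-trans d≤r (r≤n c))

  generates213 : Generates P R213 site213
  generates213 = record
    { site-≤         = λ c d≤r → ≤-trans d≤r (r≤n c)
    ; site-injective = λ _ _ _ eq → eq
    ; site-descent   = λ c d<r → ≤-pred (subst (_ <_) (r≡1+last c) d<r)
    ; site-ascent    = λ c → ≤-reflexive (sym (r≡1+last c))
    ; sound          = sound
    ; complete       = λ c {v} v≤n a → v , complete c v≤n a , refl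
    }
    where
    -- In a 213 ending in the appended value `d`, the old last entry can take the place of `d`:
    -- `w i < d ≤ 1 + w n` and distinctness give `w i < w n`. So the old word already contained a
    -- 213.
    sound : ∀ {n r} (c : Code P n r) {d} → d ≤ r →
            ¬ Occurs R213 n (word site213 c) → ¬ OccursAtEnd R213 n (word site213 c) d
    sound {suc n} c {d} d≤r a (i , j , i<j , j<1+n , wj<wi′ , wi<d′) =
      a (i , j , n , i<j , j<n , n<1+n n , wj<wi , wi<wn)
      where
      w = word site213 c
      wj<wi : w j < w i
      wj<wi = shift-reflect d wj<wi′
      wi≤wn : w i ≤ w n
      wi≤wn = ≤-pred (≤-trans (shift<⁻ wi<d′) (subst (d ≤_) (r≡1+last c) d≤r))
      i<n : i < n
      i<n = <-≤-trans i<j (≤-pred j<1+n)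
      wi<wn : w i < w n
      wi<wn = ≤∧≢⇒< wi≤wn (<⇒≢ i<n ∘ injective (permutation213 c) (m<n⇒m<1+n i<n) (n<1+n n))
      j<n : j < n
      j<n = ≤∧≢⇒< (≤-pred j<1+n) (λ { refl → <-asym wj<wi wi<wn })

    -- If v > r = 1 + w n, the value r precedes the last one and r, w n, v is a 213.
    complete : ∀ {n r} (c : Code P n r) {v} → v ≤ n →
               ¬ OccursAtEnd R213 n (word site213 c) v → v ≤ r
    complete {zero}  c v≤n _ = ≤-trans v≤n z≤n
    complete {suc n} {r} c {v} v≤n a = ≮⇒≥ absurd
      where
      w = word site213 c
      wn<r : w n < r
      wn<r = ≤-reflexive (sym (r≡1+last c))
      absurd : ¬ r < v
      absurd r<v with surjective (permutation213 c) (<-≤-trans r<v v≤n)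
      ... | i , i<1+n , wi≡r = a (i , n , i<n , n<1+n n , shift-mono v wn<wi , shift<⁺ wi<v)
        where
        wn<wi : w n < w i
        wn<wi = subst (w n <_) (sym wi≡r) wn<r
        wi<v : w i < v
        wi<v = subst (_< v) (sym wi≡r) r<v
        i<n : i < n
        i<n = ≤∧≢⇒< (≤-pred i<1+n) (λ { refl → <-irrefl refl wn<wi })

  -- The values that may be appended to a 312-avoiding word of length n are its
  -- right-to-left minima and n itself.  Appending v = site c d keeps those up to v.
  site312 : Sites P
  site312 []               _ = 0
  site312 (step {n} c d _) i with i ≤? d
  ... | yes _ = site312 c i
  -- The new top site: after the step the word has length `suc n`, and this value exceeds all its
  -- entries.
  ... | no  _ = suc n

  site312-keep : ∀ {n r} (c : Code P n r) d ch {i} → i ≤ d → site312 (step c d ch) i ≡ site312 c i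
  site312-keep c d ch {i} i≤d with i ≤? d
  ... | yes _  = refl
  ... | no i≰d = contradiction i≤d i≰d

  site312-top : ∀ {n r} (c : Code P n r) → site312 c r ≡ n
  site312-top []               = refl
  site312-top (step {n} c d _) with suc d ≤? d
  ... | yes 1+d≤d = contradiction 1+d≤d (<-irrefl refl)
  ... | no  _     = refl

  mutual
    -- A joint recursion: the bound follows from strict growth up to the top site, of value `n`, and
    -- growth into a new top site follows from the bound for the shorter code.
    site312-≤ : ∀ {n r} (c : Code P n r) {i} → i ≤ r → site312 c i ≤ n
    site312-≤ {n} {r} c {i} i≤r with m≤n⇒m<n∨m≡n i≤r
    ... | inj₁ i<r  = <⇒≤ (subst (site312 c i <_) (site312-top c) (site312-mono c i<r ≤-refl))
    ... | inj₂ refl = ≤-reflexive (site312-top c)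

    site312-mono : ∀ {n r} (c : Code P n r) {i j} → i < j → j ≤ r → site312 c i < site312 c j
    site312-mono [] () z≤n
    site312-mono (step {n} c d ch) {i} {j} i<j j≤1+d with m≤n⇒m<n∨m≡n j≤1+d
    ... | inj₁ (s≤s j≤d) = subst₂ _<_
      (sym (site312-keep c d ch (≤-trans (<⇒≤ i<j) j≤d))) (sym (site312-keep c d ch j≤d))
      (site312-mono c i<j (≤-trans j≤d (choice-≤ (P n) ch)))
    ... | inj₂ refl      = subst₂ _<_
      (sym (site312-keep c d ch (≤-pred i<j))) (sym (site312-top (step c d ch)))
      (s≤s (site312-≤ c (≤-trans (≤-pred i<j) (choice-≤ (P n) ch))))

  site312-injective : ∀ {n r} (c : Code P n r) {d e} → d ≤ r → e ≤ r → site312 c d ≡ site312 c e → d ≡ e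
  site312-injective c {d} {e} d≤r e≤r eq with <-cmp d e
  ... | tri< d<e _ _ = contradiction eq (<⇒≢ (site312-mono c d<e e≤r))
  ... | tri≈ _ d≡e _ = d≡e
  ... | tri> _ _ e<d = contradiction (sym eq) (<⇒≢ (site312-mono c e<d d≤r))

  permutation312 : ∀ {n r} (c : Code P n r) → IsPermutation n (word site312 c)
  permutation312 = word-isPermutation site312-≤

  -- Avoidance of a final 312, in terms of the entries before the shift: an entry equal to `v` moves
  -- above it, whence `v ≤ w i`.
  Active : ℕ → Word → ℕ → Set
  Active n w v = ∀ {i j} → i < j → j < n → w j < v → ¬ v ≤ w i

  active⇒¬end : ∀ {n w v} → Active n w v → ¬ OccursAtEnd R312 n w v
  active⇒¬end act (i , j , i<j , j<n , wj<v , v<wi) = act i<j j<n (shift<⁻ wj<v) (<shift⁻ v<wi)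

  ¬end⇒active : ∀ {n w v} → ¬ OccursAtEnd R312 n w v → Active n w v
  ¬end⇒active a i<j j<n wj<v v≤wi = a (_ , _ , i<j , j<n , shift<⁺ wj<v , <shift⁺ v≤wi)

  -- The top site exceeds every entry. Any other site `u` satisfies `u ≤ v` for the appended `v`:
  -- the new last entry is not below `u`, and the shift raises only entries already at or above `u`.
  site312-active : ∀ {n r} (c : Code P n r) {d} → d ≤ r →
                   Active n (word site312 c) (site312 c d)
  site312-active [] z≤n _ ()
  site312-active (step {n} c d ch) {e} e≤1+d {i} {j} i<j j<1+n w′j<u u≤w′i with m≤n⇒m<n∨m≡n e≤1+d
  ... | inj₂ refl = <⇒≱ (bounded (permutation312 (step c d ch)) (<-trans i<j j<1+n))
    (subst (_≤ word site312 (step c d ch) i) (site312-top (step c d ch)) u≤w′i)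
  ... | inj₁ (s≤s e≤d) = contra (<suc-split j<1+n)
    where
    w = word site312 c
    v = site312 c d
    u = site312 c e
    d≤r = choice-≤ (P n) ch
    u≤v : u ≤ v
    u≤v with m≤n⇒m<n∨m≡n e≤d
    ... | inj₁ e<d  = <⇒≤ (site312-mono c e<d d≤r)
    ... | inj₂ refl = ≤-refl
    keep = site312-keep c d ch e≤d

    contra : ¬ (j < n ⊎ j ≡ n)
    contra (inj₂ refl) = <⇒≱ (subst₂ _<_ (snoc-last n w v) keep w′j<u) u≤v
    contra (inj₁ j<n)  = site312-active c (≤-trans e≤d d≤r) i<j j<n wj<u u≤wi
      where
      wj<u : w j < u
      wj<u = ≤-<-trans (≤shift v (w j)) (subst₂ _<_ (snoc-init n w v j<n) keep w′j<u)
      u≤wi : u ≤ w i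
      u≤wi with w i <? v
      ... | yes wi<v = subst (u ≤_) (shift-below wi<v)
                         (subst₂ _≤_ keep (snoc-init n w v (<-trans i<j j<n)) u≤w′i)
      ... | no  wi≮v = ≤-trans u≤v (≮⇒≥ wi≮v)

  -- Three ranges of `u`: the value `suc n` is the top site; for `u ≤ v` activity passes back to the
  -- shorter word and monotonicity bounds the site by `d`; strictly between them nothing is active.
  active⇒site312 : ∀ {n r} (c : Code P n r) {v} → v ≤ n →
                   Active n (word site312 c) v → ∃[ d ] d ≤ r × v ≡ site312 c d
  active⇒site312 []                 z≤n   _   = 0 , z≤n , refl
  active⇒site312 (step {n} {r} c d ch) {u} u≤1+n act = bySize (m≤n⇒m<n∨m≡n u≤1+n) (u ≤? site312 c d)
    where
    w = word site312 c
    v = site312 c d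
    w′ = snoc n w v
    d≤r = choice-≤ (P n) ch

    site-pullback : ∀ {e} → e ≤ r → u ≡ site312 c e → u ≤ v → e ≤ d
    site-pullback e≤r refl u≤v = ≮⇒≥ λ d<e → <⇒≱ (site312-mono c d<e e≤r) u≤v

    bySize : u < suc n ⊎ u ≡ suc n → Dec (u ≤ v) →
             ∃[ e ] e ≤ suc d × u ≡ site312 (step c d ch) e
    bySize (inj₂ refl) _ = suc d , ≤-refl , sym (site312-top (step c d ch))
    bySize (inj₁ u<1+n) (yes u≤v) with active⇒site312 c (≤-pred u<1+n) old
      where
      old : Active n w u
      old {i} {j} i<j j<n wj<u u≤wi = act i<j (m<n⇒m<1+n j<n)
        (subst (_< u) (sym (trans (snoc-init n w v j<n) (shift-below (<-≤-trans wj<u u≤v)))) wj<u)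
        (subst (u ≤_) (sym (snoc-init n w v (<-trans i<j j<n))) (≤-trans u≤wi (≤shift v (w i))))
    ... | e , e≤r , u≡ = e , m≤n⇒m≤1+n e≤d , trans u≡ (sym (site312-keep c d ch e≤d))
      where e≤d = site-pullback e≤r u≡ u≤v
    -- Here the largest value n of w′ precedes v, its last one, and v < u ≤ n.
    bySize (inj₁ (s≤s u≤n)) (no u≰v) with surjective (permutation312 (step c d ch)) (n<1+n n)
    ... | i , i<1+n , w′i≡n = contradiction (subst (u ≤_) (sym w′i≡n) u≤n)
      (act i<n (n<1+n n) (subst (_< u) (sym (snoc-last n w v)) (≰⇒> u≰v)))
      where
      i<n : i < n
      i<n = ≤∧≢⇒< (≤-pred i<1+n) λ { refl →
        u≰v (subst (u ≤_) (trans (sym w′i≡n) (snoc-last n w v)) u≤n) }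

  generates312 : Generates P R312 site312
  generates312 = record
    { site-≤         = site312-≤
    ; site-injective = site312-injective
    ; site-descent   = descent
    ; site-ascent    = λ {n} c → subst (word site312 c n <_) (sym (site312-top c))
                         (bounded (permutation312 c) (n<1+n n))
    ; sound          = λ c d≤r _ → active⇒¬end (site312-active c d≤r)
    ; complete       = λ c v≤n a → active⇒site312 c v≤n (¬end⇒active a)
    }
    where
    -- Otherwise the largest value n precedes the last one, which makes v inactive.
    descent : ∀ {n r} (c : Code P (suc n) r) {d} → d < r →
              site312 c d ≤ word site312 c n
    descent {n} c {d} d<r = ≮⇒≥ absurd
      where
      w = word site312 c
      v = site312 c d
      v≤n : v ≤ n
      v≤n = ≤-pred (subst (v <_) (site312-top c) (site312-mono c d<r ≤-refl))
      absurd : ¬ w n < v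
      absurd wn<v with surjective (permutation312 c) (n<1+n n)
      ... | i , i<1+n , wi≡n = site312-active c (<⇒≤ d<r) i<n (n<1+n n) wn<v (subst (v ≤_) (sym wi≡n) v≤n)
        where
        i<n : i < n
        i<n = ≤∧≢⇒< (≤-pred i<1+n) (λ { refl → <⇒≱ wn<v (subst (v ≤_) (sym wi≡n) v≤n) })

-- From permutations of Fin N to words

toWord : ∀ {N} → Permutation′ N → Word
toWord {N} π i with i <? N
... | yes i<N = toℕ (π ⟨$⟩ʳ fromℕ< i<N)
... | no  _   = 0

-- Serves both directions, `toWord` of a permutation and `toPermutation` of a word; as a record it
-- lets `w` and `π` be inferred from the proof.
record Represents {N : ℕ} (w : Word) (π : Permutation′ N) : Set where
  constructor represents
  field
    entry : ∀ a → w (toℕ a) ≡ toℕ (π ⟨$⟩ʳ a)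

open Represents

toWord-represents : ∀ {N} (π : Permutation′ N) → Represents (toWord π) π
entry (toWord-represents {N} π) a with toℕ a <? N
... | yes a<N = cong (toℕ ∘ (π ⟨$⟩ʳ_)) (Fin.fromℕ<-toℕ a a<N)
... | no  a≮N = contradiction (toℕ<n a) a≮N

module _ {N : ℕ} {w : Word} {π : Permutation′ N} (rep : Represents w π) where

  represents-at : ∀ {i} (i<N : i < N) → w i ≡ toℕ (π ⟨$⟩ʳ fromℕ< i<N)
  represents-at i<N = trans (cong w (sym (toℕ-fromℕ< i<N))) (entry rep (fromℕ< i<N))

  represents-isPermutation : IsPermutation N w
  represents-isPermutation = record
    { bounded    = λ i<N → subst (_< N) (sym (represents-at i<N)) (toℕ<n _)
    ; injective  = inj
    ; surjective = λ {v} v<N → let a = π ⟨$⟩ˡ fromℕ< v<N in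
        toℕ a , toℕ<n a , trans (entry rep a) (trans (cong toℕ (inverseʳ π)) (toℕ-fromℕ< v<N))
    }
    where
    inj : ∀ {i j} → i < N → j < N → w i ≡ w j → i ≡ j
    inj {i} {j} i<N j<N eq = begin
      i                   ≡⟨ toℕ-fromℕ< i<N ⟨
      toℕ (fromℕ< i<N)    ≡⟨ cong toℕ πa≡πb ⟩
      toℕ (fromℕ< j<N)    ≡⟨ toℕ-fromℕ< j<N ⟩
      j                   ∎
      where
      open ≡-Reasoning
      πa≡πb : fromℕ< i<N ≡ fromℕ< j<N
      πa≡πb = trans (sym (inverseˡ π)) (trans (cong (π ⟨$⟩ˡ_) (toℕ-injective
        (trans (sym (represents-at i<N)) (trans eq (represents-at j<N))))) (inverseˡ π))

  des⇒descent : ∀ {i} → Des π (suc i) → suc i < N × w (suc i) < w i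
  des⇒descent (a , b , refl , b≡ , πb<πa) =
    subst (_< N) (suc-injective b≡) (toℕ<n b) ,
    subst₂ _<_ (trans (sym (entry rep b)) (cong w (suc-injective b≡))) (sym (entry rep a)) πb<πa

  descent⇒des : ∀ {i} → suc i < N → w (suc i) < w i → Des π (suc i)
  descent⇒des 1+i<N lt =
    fromℕ< (<⇒≤ 1+i<N) , fromℕ< 1+i<N ,
    cong suc (toℕ-fromℕ< (<⇒≤ 1+i<N)) , cong suc (toℕ-fromℕ< 1+i<N) ,
    subst₂ _<_ (represents-at 1+i<N) (represents-at (<⇒≤ 1+i<N)) lt

Matches : Permutation′ 3 → Pattern → Set
Matches p R = ∀ {N w} {π : Permutation′ N} → Represents w π → Contains π p ⇔ Occurs R N w

-- Preserving a strict total order entails reflecting it; a tie in `p` forces `i ≡ j` because `p` is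
-- injective.
order-embedding : ∀ {N r} (π : Permutation′ N) (p : Permutation′ r) (σ : Fin r → Fin N) →
  (∀ i j → (p ⟨$⟩ʳ i) Fin.< (p ⟨$⟩ʳ j) → (π ⟨$⟩ʳ σ i) Fin.< (π ⟨$⟩ʳ σ j)) →
  ∀ i j → ((p ⟨$⟩ʳ i) Fin.< (p ⟨$⟩ʳ j)) ⇔ ((π ⟨$⟩ʳ σ i) Fin.< (π ⟨$⟩ʳ σ j))
order-embedding π p σ mono i j = mk⇔ (mono i j) reflects
  where
  reflects : (π ⟨$⟩ʳ σ i) Fin.< (π ⟨$⟩ʳ σ j) → (p ⟨$⟩ʳ i) Fin.< (p ⟨$⟩ʳ j)
  reflects lt with Fin.<-cmp (p ⟨$⟩ʳ i) (p ⟨$⟩ʳ j)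
  ... | tri< pi<pj _ _ = pi<pj
  ... | tri> _ _ pj<pi = contradiction lt (<-asym (mono j i pj<pi))
  ... | tri≈ _ pi≡pj _ = contradiction
    (cong (toℕ ∘ (π ⟨$⟩ʳ_) ∘ σ)
      (trans (sym (inverseˡ p)) (trans (cong (p ⟨$⟩ˡ_) pi≡pj) (inverseˡ p))))
    (<⇒≢ lt)

triple : ∀ {A : Set} → A → A → A → Fin 3 → A
triple a b c 0F = a
triple a b c 1F = b
triple a b c 2F = c

triple-increasing : ∀ {N} {a b c : Fin N} → a Fin.< b → b Fin.< c →
                    ∀ i j → i Fin.< j → triple a b c i Fin.< triple a b c j
triple-increasing a<b b<c 0F 1F _ = a<b
triple-increasing a<b b<c 0F 2F _ = <-trans a<b b<c
triple-increasing a<b b<c 1F 2F _ = b<c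
triple-increasing a<b b<c 1F 1F (s≤s ())
triple-increasing a<b b<c 2F 1F (s≤s ())
triple-increasing a<b b<c 2F 2F (s≤s (s≤s ()))

module _ (p : Permutation′ 3) (R : Pattern)
  (relate   : ∀ {N} (π : Permutation′ N) (σ : Fin 3 → Fin N) →
     (∀ i j → (p ⟨$⟩ʳ i) Fin.< (p ⟨$⟩ʳ j) → (π ⟨$⟩ʳ σ i) Fin.< (π ⟨$⟩ʳ σ j)) ⇔
     R (toℕ (π ⟨$⟩ʳ σ 0F)) (toℕ (π ⟨$⟩ʳ σ 1F)) (toℕ (π ⟨$⟩ʳ σ 2F)))
  where

  matches : Matches p R
  matches {N} {w} {π} rep = mk⇔ occurs contains
    where
    occurs : Contains π p → Occurs R N w
    occurs (σ , inc , emb) = toℕ (σ 0F) , toℕ (σ 1F) , toℕ (σ 2F) ,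
      inc 0F 1F (s≤s z≤n) , inc 1F 2F (s≤s (s≤s z≤n)) , toℕ<n (σ 2F) ,
      transport₃ R (sym (entry rep (σ 0F))) (sym (entry rep (σ 1F))) (sym (entry rep (σ 2F)))
        (Equivalence.to (relate π σ) (λ i j → Equivalence.to (emb i j)))

    contains : Occurs R N w → Contains π p
    contains (i , j , l , i<j , j<l , l<N , r) =
      σ , triple-increasing (fromℕ<-mono i<N j<N i<j) (fromℕ<-mono j<N l<N j<l) ,
      order-embedding π p σ (Equivalence.from (relate π σ)
        (transport₃ R (represents-at rep i<N) (represents-at rep j<N) (represents-at rep l<N) r))
      where
      j<N = <-trans j<l l<N
      i<N = <-trans i<j j<N
      σ = triple (fromℕ< i<N) (fromℕ< j<N) (fromℕ< l<N)
      fromℕ<-mono : ∀ {x y} (x<N : x < N) (y<N : y < N) → x < y → fromℕ< x<N Fin.< fromℕ< y<N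
      fromℕ<-mono x<N y<N = subst₂ _<_ (sym (toℕ-fromℕ< x<N)) (sym (toℕ-fromℕ< y<N))

-- The comparisons of neighbouring pattern values suffice; that of the smallest with the largest
-- follows by transitivity.
matches213 : Matches pattern213 R213
matches213 = matches pattern213 R213 λ π σ → mk⇔
  (λ f → f 1F 0F (s≤s z≤n) , f 0F 2F (s≤s (s≤s z≤n)))
  λ { (y<x , x<z) → λ
      { 1F 0F _ → y<x
      ; 0F 2F _ → x<z
      ; 1F 2F _ → <-trans y<x x<z
      ; 0F 0F (s≤s ())
      ; 2F 0F (s≤s ())
      ; 2F 2F (s≤s (s≤s ()))
      } }

matches312 : Matches pattern312 R312
matches312 = matches pattern312 R312 λ π σ → mk⇔
  (λ f → f 1F 2F (s≤s z≤n) , f 2F 0F (s≤s (s≤s z≤n)))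
  λ { (y<z , z<x) → λ
      { 1F 2F _ → y<z
      ; 2F 0F _ → z<x
      ; 1F 0F _ → <-trans y<z z<x
      ; 2F 2F (s≤s ())
      ; 0F 2F (s≤s ())
      ; 0F 0F (s≤s (s≤s ()))
      } }

toPermutation : ∀ {N w} → IsPermutation N w → Permutation′ N
toPermutation {N} {w} p = permutation
  (λ a → fromℕ< (bounded p (toℕ<n a)))
  (λ b → fromℕ< (proj₁ (proj₂ (surjective p (toℕ<n b)))))
  (λ b → let i , i<N , wi≡b = surjective p (toℕ<n b) in toℕ-injective
     (trans (toℕ-fromℕ< _) (trans (cong w (toℕ-fromℕ< i<N)) wi≡b)))
  (λ a → let i , i<N , wi≡ = surjective p (toℕ<n (fromℕ< (bounded p (toℕ<n a)))) in toℕ-injective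
     (trans (toℕ-fromℕ< _) (injective p i<N (toℕ<n a) (trans wi≡ (toℕ-fromℕ< _)))))

toPermutation-represents : ∀ {N w} (p : IsPermutation N w) → Represents w (toPermutation p)
entry (toPermutation-represents p) a = sym (toℕ-fromℕ< _)

-- Descents at the multiples of k, and codes for the permutation classes

module _ (k : ℕ) .{{k>1 : NonTrivial k}} where
  private instance
    k≢0 : NonZero k
    k≢0 = nonTrivial⇒nonZero k

  isMultiple : ℕ → Bool
  -- The prescribed multiples start at `k`, and this value supplies `P0` of `Generation`.
  isMultiple zero        = false
  isMultiple i@(suc _) = i % k ≡ᵇ 0

  isMultiple⁺ : ∀ {i} j → suc i ≡ j * k → isMultiple (suc i) ≡ true
  isMultiple⁺ j eq = cong (_≡ᵇ 0) (trans (cong (_% k) eq) (m*n%n≡0 j k))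

  isMultiple⁻ : ∀ {i} → isMultiple (suc i) ≡ true → k ∣ suc i
  isMultiple⁻ {i} eq with suc i % k in r≡
  ... | zero = m%n≡0⇒n∣m (suc i) k r≡

  multiples⁻ : ∀ {N i} → Multiples N k i → ∃[ i′ ] i ≡ suc i′ × suc i′ < N × isMultiple i ≡ true
  multiples⁻ {suc N} {zero}  (suc j , _ , _ , eq) =
    contradiction (m+n≡0⇒m≡0 k (sym eq)) (≢-nonZero⁻¹ k)
  multiples⁻ {suc N} {suc i} (j , _ , j≤ , eq) = i , refl ,
    s≤s (≤-trans (≤-reflexive eq) (≤-trans (*-monoˡ-≤ k j≤) (m/n*n≤m N k))) , isMultiple⁺ j eq
  -- For `N = 0` truncated subtraction makes the quotient 0, below every `j ≥ 1`.
  multiples⁻ {zero} (suc j , _ , j≤ , eq) = contradiction (≤-trans j≤ (≤-reflexive (0/n≡0 k))) λ ()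

  multiples⁺ : ∀ {N i} → suc i < N → isMultiple (suc i) ≡ true → Multiples N k (suc i)
  multiples⁺ {suc N} {i} (s≤s i<N) eq with isMultiple⁻ eq
  ... | divides zero    ()
  ... | divides (suc j) i≡ = suc j , s≤s z≤n ,
    subst (_≤ N ℕ./ k) (trans (cong (ℕ._/ k) i≡) (m*n/n≡m (suc j) k)) (/-monoˡ-≤ k i<N) , i≡

  module _ {N : ℕ} {w : Word} {π : Permutation′ N} (rep : Represents w π) where

    -- Where no descent is allowed, neighbouring entries must ascend because they are distinct.
    des⇒follows : Des π ≐ Multiples N k → Follows isMultiple N w
    des⇒follows (des⊆ , ⊆des) {i} 1+i<N with isMultiple (suc i) in eq
    ... | true  = proj₂ (des⇒descent rep (⊆des (multiples⁺ 1+i<N eq)))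
    ... | false = ≤∧≢⇒< (≮⇒≥ λ lt → noDescent (multiples⁻ {N} (des⊆ (descent⇒des rep 1+i<N lt))))
      (<⇒≢ (n<1+n i) ∘ injective (represents-isPermutation rep) (<⇒≤ 1+i<N) 1+i<N)
      where
      noDescent : ¬ (∃[ i′ ] suc i ≡ suc i′ × suc i′ < N × isMultiple (suc i) ≡ true)
      noDescent (_ , _ , _ , eq′) = contradiction (trans (sym eq) eq′) λ ()

    follows⇒des : Follows isMultiple N w → Des π ≐ Multiples N k
    follows⇒des f = des⊆ , ⊆des
      where
      des⊆ : ∀ {i} → Des π i → Multiples N k i
      des⊆ {suc i} d@(_ , _ , _ , _ , _) with des⇒descent rep d
      ... | 1+i<N , lt with isMultiple (suc i) in eq | f 1+i<N
      ...   | true  | _  = multiples⁺ 1+i<N eq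
      ...   | false | gt = contradiction lt (<-asym gt)

      ⊆des : ∀ {i} → Multiples N k i → Des π i
      ⊆des m with multiples⁻ {N} m
      ... | i , refl , 1+i<N , eq =
        descent⇒des rep 1+i<N (subst (λ b → Direction b (w i) (w (suc i))) eq (f 1+i<N))

  Codes : ℕ → Set
  Codes N = ∃[ r ] Code isMultiple N r

  module _ {p : Permutation′ 3} {R : Pattern} (m : Matches p R) (R-shift : ShiftInvariant R)
           {site : Sites isMultiple} (G : Generates isMultiple R site) where
    open Generates G using (site-≤)
    open Generation refl R-shift G

    -- A code is determined by its word (`same`), and elements of the class are compared entrywise,
    -- so both inverse laws reduce to comparing words.
    𝒟↔codes : ∀ N → Inverse (𝒟 N k p) (setoid (Codes N))
    𝒟↔codes N = record
      { to        = code
      ; from      = perm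
      ; to-cong   = λ {x} {y} x≈y → same {code x} {code y} λ a →
          trans (code-word x a) (trans (cong toℕ (x≈y a)) (sym (code-word y a)))
      ; from-cong = λ { refl a → refl }
      ; inverse   = (λ {c} {y} y≈ → same {code y} {c} λ a →
          trans (code-word y a) (trans (cong toℕ (y≈ a)) (sym (perm-word c a))))
        , λ { {x} refl a → toℕ-injective (trans (sym (perm-word (code x) a)) (code-word x a)) }
      }
      where
      Class = Σ[ π ∈ Permutation′ N ] (Des π ≐ Multiples N k × Avoids π p)

      wordOf : Codes N → Word
      wordOf (_ , c) = word site c

      perm : Codes N → Class
      perm (r , c) = toPermutation q , follows⇒des rep (word-follows c) ,
                     word-avoids c ∘ Equivalence.to (m rep)
        where
        q = word-isPermutation site-≤ c
        rep = toPermutation-represents q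

      codeWithWord : ((π , _) : Class) → ∃[ r ] Σ[ c ∈ Code isMultiple N r ] word site c ≗[ N ] toWord π
      codeWithWord (π , des , av) = word-surjective N (toWord π) (represents-isPermutation rep)
        (des⇒follows rep des) (av ∘ Equivalence.from (m rep))
        where rep = toWord-represents π

      code : Class → Codes N
      code x = let r , c , _ = codeWithWord x in r , c

      code-word : ∀ x (a : Fin N) → wordOf (code x) (toℕ a) ≡ toℕ (proj₁ x ⟨$⟩ʳ a)
      code-word x a = trans (proj₂ (proj₂ (codeWithWord x)) (toℕ<n a)) (entry (toWord-represents (proj₁ x)) a)

      perm-word : ∀ c (a : Fin N) → wordOf c (toℕ a) ≡ toℕ (proj₁ (perm c) ⟨$⟩ʳ a)
      perm-word (r , c) = entry (toPermutation-represents (word-isPermutation site-≤ c))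

      same : ∀ {c c′} → (∀ (a : Fin N) → wordOf c (toℕ a) ≡ wordOf c′ (toℕ a)) → c ≡ c′
      same {_ , c} {_ , c′} eq = word-injective c c′ λ i<N →
        subst (λ i → word site c i ≡ word site c′ i) (toℕ-fromℕ< i<N) (eq (fromℕ< i<N))

-- Counting codes and trees

sumBelow : ℕ → (ℕ → ℕ) → ℕ
sumBelow zero    f = 0
sumBelow (suc r) f = sumBelow r f + f r

sumBelow-cong : ∀ r {f g : ℕ → ℕ} → (∀ d → f d ≡ g d) → sumBelow r f ≡ sumBelow r g
sumBelow-cong zero    f≗g = refl
sumBelow-cong (suc r) f≗g = cong₂ _+_ (sumBelow-cong r f≗g) (f≗g r)

below-suc↔ : ∀ {A : ℕ → Set} r → (∃[ d ] d < suc r × A d) ↔ ((∃[ d ] d < r × A d) ⊎ A r)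
below-suc↔ {A} r = mk↔ₛ′ to from to∘from from∘to
  where
  split : ∀ {d} → A d → d < r ⊎ d ≡ r → (∃[ d ] d < r × A d) ⊎ A r
  split a (inj₁ d<r)  = inj₁ (_ , d<r , a)
  split a (inj₂ refl) = inj₂ a
  to : (∃[ d ] d < suc r × A d) → (∃[ d ] d < r × A d) ⊎ A r
  to (d , d<1+r , a) = split a (<suc-split d<1+r)
  from : (∃[ d ] d < r × A d) ⊎ A r → ∃[ d ] d < suc r × A d
  from (inj₁ (d , d<r , a)) = d , m<n⇒m<1+n d<r , a
  from (inj₂ a)             = r , n<1+n r , a
  to∘from : ∀ y → to (from y) ≡ y
  to∘from (inj₁ (d , d<r , a)) with <suc-split (m<n⇒m<1+n d<r)
  ... | inj₁ d<r′ = cong (λ z → inj₁ (d , z , a)) (<-irrelevant d<r′ d<r)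
  ... | inj₂ refl = contradiction d<r (<-irrefl refl)
  to∘from (inj₂ a) with <suc-split (n<1+n r)
  ... | inj₁ r<r  = contradiction r<r (<-irrefl refl)
  ... | inj₂ refl = refl
  from∘to : ∀ x → from (to x) ≡ x
  from∘to (d , d<1+r , a) with <suc-split d<1+r
  ... | inj₁ d<r  = cong (λ z → d , z , a) (<-irrelevant _ _)
  ... | inj₂ refl = cong (λ z → r , z , a) (<-irrelevant _ _)

below↔Fin : ∀ {A : ℕ → Set} {f} r → (∀ d → A d ↔ Fin (f d)) → (∃[ d ] d < r × A d) ↔ Fin (sumBelow r f)
below↔Fin zero    A↔ = mk↔ₛ′ (λ ()) (λ ()) (λ ()) (λ ())
below↔Fin (suc r) A↔ =
  ↔-trans (below-suc↔ r) (↔-trans (below↔Fin r A↔ ⊎-↔ A↔ r) (↔-sym +↔⊎))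

sumChoices : Bool → ℕ → (ℕ → ℕ) → ℕ
sumChoices true  r f = sumBelow r f
sumChoices false r f = f r

choices↔Fin : ∀ b {A : ℕ → Set} {f} r → (∀ d → A d ↔ Fin (f d)) →
              (∃[ d ] Choice b r d × A d) ↔ Fin (sumChoices b r f)
choices↔Fin true  r A↔ = below↔Fin r A↔
choices↔Fin false r A↔ = ↔-trans
  (mk↔ₛ′ (λ { (_ , refl , a) → a }) (λ a → r , refl , a) (λ _ → refl) (λ { (_ , refl , _) → refl })) (A↔ r)

module _ (P : ℕ → Bool) where

  -- The ways of extending a Code P n r by l further steps.
  Walk : ℕ → ℕ → ℕ → Set
  Walk n zero    r = ⊤
  Walk n (suc l) r = ∃[ d ] Choice (P n) r d × Walk (suc n) l (suc d)

  count : ℕ → ℕ → ℕ → ℕ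
  count n zero    r = 1
  count n (suc l) r = sumChoices (P n) r λ d → count (suc n) l (suc d)

  walk↔Fin : ∀ n l r → Walk n l r ↔ Fin (count n l r)
  walk↔Fin n zero    r = ↔-sym 1↔⊤
  walk↔Fin n (suc l) r = choices↔Fin (P n) r λ d → walk↔Fin (suc n) l (suc d)

  step↔ : ∀ n l → (∃[ r ] Code P n r × Walk n (suc l) r) ↔ (∃[ r ] Code P (suc n) r × Walk (suc n) l r)
  step↔ n l = mk↔ₛ′ to from (λ { (_ , step c d ch , w) → refl }) (λ _ → refl)
    where
    to : (∃[ r ] Code P n r × Walk n (suc l) r) → ∃[ r ] Code P (suc n) r × Walk (suc n) l r
    to (r , c , d , ch , w) = suc d , step c d ch , w
    from : (∃[ r ] Code P (suc n) r × Walk (suc n) l r) → ∃[ r ] Code P n r × Walk n (suc l) r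
    from (_ , step c d ch , w) = _ , c , d , ch , w

  -- A code is taken apart from its last step, whereas the options at a step depend on the earlier
  -- ones. Moving steps from the walk onto the code turns counting into a forward recursion.
  codeWalk↔ : ∀ n l → (∃[ r ] Code P n r × Walk n l r) ↔ (∃[ r ] Code P (l + n) r)
  codeWalk↔ n zero    = mk↔ₛ′ (λ (r , c , _) → r , c) (λ (r , c) → r , c , tt) (λ _ → refl) (λ _ → refl)
  codeWalk↔ n (suc l) = ↔-trans (step↔ n l) (subst
    (λ N → (∃[ r ] Code P (suc n) r × Walk (suc n) l r) ↔ (∃[ r ] Code P N r))
    (+-suc l n) (codeWalk↔ (suc n) l))

  code↔Fin : ∀ N → (∃[ r ] Code P N r) ↔ Fin (count 0 N 0)
  code↔Fin N = ↔-trans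
    (↔-trans
      (subst (λ M → (∃[ r ] Code P M r) ↔ (∃[ r ] Code P 0 r × Walk 0 N r))
        (+-identityʳ N) (↔-sym (codeWalk↔ 0 N)))
      (mk↔ₛ′ (λ { (_ , [] , w) → w }) (λ w → 0 , [] , w) (λ _ → refl) (λ { (_ , [] , _) → refl })))
    (walk↔Fin 0 N 0)

  -- An ascent has the single option `d ≡ r` and leaves `suc r`, so a run of `u` ascents adds `u`
  -- sites without branching.
  count-ascents : ∀ u n l r → (∀ {i} → n ≤ i → i < u + n → P i ≡ false) →
                  count n (u + l) r ≡ count (u + n) l (u + r)
  count-ascents zero    n l r _      = refl
  count-ascents (suc u) n l r ascent rewrite ascent ≤-refl (s≤s (m≤n+m n u)) = begin
    count (suc n) (u + l) (suc r)      ≡⟨ count-ascents u (suc n) l (suc r) (λ {i} n<i i< →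
                                            ascent (<⇒≤ n<i) (subst (i <_) (+-suc u n) i<)) ⟩
    count (u + suc n) l (u + suc r)    ≡⟨ cong₂ (λ n r → count n l r) (+-suc u n) (+-suc u r) ⟩
    count (suc u + n) l (suc u + r)    ∎
    where open ≡-Reasoning

-- The number of ordered forests of r complete k-ary trees with n internal
-- vertices in all, counted by the number d of trees to the right of the first
-- one that is not a leaf.
forests : ℕ → ℕ → ℕ → ℕ
forests k r zero    = 1
forests k r (suc n) = sumBelow r λ d → forests k (k + d) n

module _ (K : ℕ) .{{k>1 : NonTrivial (suc K)}} where
  private k = suc K

  between-multiples : ∀ j {i} → j * k < i → i < suc j * k → isMultiple k i ≡ false
  between-multiples j {suc i} j*k<i i<1+j*k with isMultiple k (suc i) in eq
  ... | false = refl
  ... | true with isMultiple⁻ k eq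
  ...   | divides q i≡ = contradiction (*-cancelʳ-< k j q (subst (j * k <_) i≡ j*k<i))
                           (<⇒≱ (*-cancelʳ-< k q (suc j) (subst (_< suc j * k) i≡ i<1+j*k)))

  -- A block opens with a descent choosing `d < r` and leaving `suc d`; its `K` ascents lift this to
  -- `k + d`, as in the recursion of `forests`. The last block has length `s`, and only its first
  -- step branches.
  count-fromMultiple : ∀ m j {s} r → 1 ≤ s → s ≤ k →
                       count (isMultiple k) (suc j * k) (m * k + s) r ≡ forests k r (suc m)
  count-fromMultiple zero    j {suc s} r _ (s≤s s≤K) rewrite isMultiple⁺ k (suc j) refl =
    sumBelow-cong r λ d → begin
      count P (suc n) s (suc d)              ≡⟨ cong (λ l → count P (suc n) l (suc d)) (+-identityʳ s) ⟨
      count P (suc n) (s + 0) (suc d)        ≡⟨ count-ascents P s (suc n) 0 (suc d) (λ n<i i< →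
        between-multiples (suc j) n<i (<-≤-trans i< (≤-trans (+-monoˡ-≤ (suc n) s≤K) (≤-reflexive (+-suc K n))))) ⟩
      1                                      ∎
    where
    open ≡-Reasoning
    P = isMultiple k
    n = suc j * k
  count-fromMultiple (suc m) j {s} r 1≤s s≤k rewrite isMultiple⁺ k (suc j) refl =
    sumBelow-cong r λ d → begin
      count P (suc n) ((K + m * k) + s) (suc d)   ≡⟨ cong (λ l → count P (suc n) l (suc d)) (+-assoc K (m * k) s) ⟩
      count P (suc n) (K + (m * k + s)) (suc d)   ≡⟨ count-ascents P K (suc n) (m * k + s) (suc d) (λ n<i i< →
        between-multiples (suc j) n<i (<-≤-trans i< (≤-reflexive (+-suc K n)))) ⟩
      count P (K + suc n) (m * k + s) (K + suc d) ≡⟨ cong₂ (λ n r → count P n (m * k + s) r) (+-suc K n) (+-suc K d) ⟩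
      count P (k + n) (m * k + s) (k + d)         ≡⟨ count-fromMultiple m (suc j) (k + d) 1≤s s≤k ⟩
      forests k (k + d) (suc m)                   ∎
    where
    open ≡-Reasoning
    P = isMultiple k
    n = suc j * k

  -- The first block has ascents only and takes the number of sites from 0 to `k`, matching the `k`
  -- subtrees of the root.
  count≡forests : ∀ m {s} → 1 ≤ s → s ≤ k → count (isMultiple k) 0 (m * k + s) 0 ≡ forests k k m
  count≡forests m {s} 1≤s s≤k = byBlocks m
    where
    open ≡-Reasoning
    P = isMultiple k
    firstBlock : ∀ {i} → i < k → P i ≡ false
    firstBlock {zero}  _     = refl
    firstBlock {suc i} 1+i<k = between-multiples 0 (s≤s z≤n) (subst (suc i <_) (sym (+-identityʳ k)) 1+i<k)

    byBlocks : ∀ m → count P 0 (m * k + s) 0 ≡ forests k k m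
    byBlocks zero    = begin
      count P 0 s 0        ≡⟨ cong (λ l → count P 0 l 0) (+-identityʳ s) ⟨
      count P 0 (s + 0) 0  ≡⟨ count-ascents P s 0 0 0
                                (λ _ i<s → firstBlock (<-≤-trans i<s (≤-trans (≤-reflexive (+-identityʳ s)) s≤k))) ⟩
      1                    ∎
    byBlocks (suc m) = begin
      count P 0 (k + m * k + s) 0            ≡⟨ cong (λ l → count P 0 l 0) (+-assoc k (m * k) s) ⟩
      count P 0 (k + (m * k + s)) 0          ≡⟨ count-ascents P k 0 (m * k + s) 0
                                                  (λ {i} _ i<k → firstBlock (subst (i <_) (+-identityʳ k) i<k)) ⟩
      -- Only the last argument is simplified: `k + 0` in the first is what `1 * k` computes to.
      count P (k + 0) (m * k + s) (k + 0)    ≡⟨ cong (count P (k + 0) (m * k + s)) (+-identityʳ k) ⟩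
      count P (k + 0) (m * k + s) k          ≡⟨ count-fromMultiple m 0 k 1≤s s≤k ⟩
      forests k k (suc m)                    ∎

-- Forests of complete k-ary trees

Forest : ℕ → ℕ → ℕ → Set
Forest k r n = Σ[ ts ∈ Vec (Tree k) r ] internalVerticesOfAll ts ≡ n

forest-≡ : ∀ {k r n} {us ts : Vec (Tree k) r} {p : internalVerticesOfAll us ≡ n}
             {q : internalVerticesOfAll ts ≡ n} → us ≡ ts → _≡_ {A = Forest k r n} (us , p) (ts , q)
forest-≡ {us = us} refl = cong (us ,_) (≡-irrelevant _ _)

internalVertices-++ : ∀ {k q r} (us : Vec (Tree k) q) (ts : Vec (Tree k) r) →
  internalVerticesOfAll (us ++ ts) ≡ internalVerticesOfAll us + internalVerticesOfAll ts
internalVertices-++ []       ts = refl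
internalVertices-++ (u ∷ us) ts = trans (cong (_+_ (internalVertices u)) (internalVertices-++ us ts))
  (sym (+-assoc (internalVertices u) _ _))

module _ {k : ℕ} where

  forest-leaf↔ : ∀ r → Forest k (suc r) 0 ↔ Forest k r 0
  forest-leaf↔ r = mk↔ₛ′ (λ { (leaf ∷ ts , eq) → ts , eq }) (λ (ts , eq) → leaf ∷ ts , eq)
    (λ _ → refl) (λ { (leaf ∷ ts , eq) → refl })

  -- A first tree that is a leaf is dropped; otherwise its root is removed and its `k` subtrees join
  -- the front. The two cases are the summands into which `sumBelow` splits
  -- `forests k (suc r) (suc n)`.
  forest-suc↔ : ∀ r n → Forest k (suc r) (suc n) ↔ (Forest k r (suc n) ⊎ Forest k (k + r) n)
  forest-suc↔ r n = mk↔ₛ′ to from to∘from from∘to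
    where
    to : Forest k (suc r) (suc n) → Forest k r (suc n) ⊎ Forest k (k + r) n
    to (leaf    ∷ ts , eq) = inj₁ (ts , eq)
    to (node us ∷ ts , eq) = inj₂ (us ++ ts , trans (internalVertices-++ us ts) (suc-injective eq))
    from : Forest k r (suc n) ⊎ Forest k (k + r) n → Forest k (suc r) (suc n)
    from (inj₁ (ts , eq)) = leaf ∷ ts , eq
    from (inj₂ (vs , eq)) = node (take k vs) ∷ drop k vs , cong suc (trans
      (sym (internalVertices-++ (take k vs) (drop k vs)))
      (trans (cong internalVerticesOfAll (take++drop≡id k vs)) eq))
    to∘from : ∀ y → to (from y) ≡ y
    to∘from (inj₁ _)        = refl
    to∘from (inj₂ (vs , _)) = cong inj₂ (forest-≡ (take++drop≡id k vs))
    from∘to : ∀ x → from (to x) ≡ x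
    from∘to (leaf    ∷ ts , _) = refl
    from∘to (node us ∷ ts , _) = forest-≡ (cong₂ (λ us ts → node us ∷ ts)
      (proj₁ pieces) (proj₂ pieces))
      where pieces = ++-injective (take k (us ++ ts)) us (take++drop≡id k (us ++ ts))

  -- Recursion on `n` first and then on `r`: opening a node enlarges the forest but uses up an
  -- internal vertex.
  forest↔Fin : ∀ n r → Forest k r n ↔ Fin (forests k r n)
  forest↔Fin zero    zero    = ↔-trans
    (mk↔ₛ′ (λ _ → tt) (λ _ → [] , refl) (λ _ → refl) (λ { ([] , refl) → refl })) (↔-sym 1↔⊤)
  forest↔Fin zero    (suc r) = ↔-trans (forest-leaf↔ r) (forest↔Fin zero r)
  forest↔Fin (suc n) zero    = mk↔ₛ′ (λ { ([] , ()) }) (λ ()) (λ ()) (λ { ([] , ()) })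
  forest↔Fin (suc n) (suc r) = ↔-trans (forest-suc↔ r n)
    (↔-trans (forest↔Fin (suc n) r ⊎-↔ forest↔Fin n (k + r)) (↔-sym +↔⊎))

  trees↔forest : ∀ n → Inverse (Trees k (suc n)) (setoid (Forest k k n))
  trees↔forest n = record
    { to        = children
    ; from      = λ (ts , eq) → node ts , cong suc eq
    ; to-cong   = λ {x} {y} → children-cong {x} {y}
    ; from-cong = λ { refl → refl }
    ; inverse   = (λ { refl → forest-≡ refl }) , λ { {node ts , eq} refl → refl }
    }
    where
    RootedTree = Σ[ t ∈ Tree k ] internalVertices t ≡ suc n
    children : RootedTree → Forest k k n
    children (node ts , eq) = ts , suc-injective eq
    children-cong : ∀ {x y : RootedTree} → proj₁ x ≡ proj₁ y → children x ≡ children y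
    children-cong {node _ , _} {node _ , _} refl = forest-≡ refl

-- Fuss–Catalan numbers

open ≡-Reasoning

-- Pascal's rule with `suc (suc k)` split as `1 + suc k`, so that induction applies to both
-- binomials.
absorption : ∀ n k → suc k * (suc n C suc k) ≡ suc n * (n C k)
absorption zero    zero    = refl
absorption zero    (suc k) = trans (cong (suc (suc k) *_) (k>n⇒nCk≡0 {1} {suc (suc k)} (s≤s (s≤s z≤n))))
  (trans (*-zeroʳ (suc (suc k))) (sym (cong (1 *_) (k>n⇒nCk≡0 {0} {suc k} (s≤s z≤n)))))
absorption (suc n) zero    = trans (*-identityˡ _) (trans (nC1≡n (suc (suc n))) (sym (*-identityʳ _)))
absorption (suc n) (suc k) = begin
  suc (suc k) * (suc (suc n) C suc (suc k))
    ≡⟨ cong (suc (suc k) *_) (nCk+nC[k+1]≡[n+1]C[k+1] (suc n) (suc k)) ⟨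
  suc (suc k) * (a + (suc n C suc (suc k)))
    ≡⟨ *-distribˡ-+ (suc (suc k)) a _ ⟩
  (a + suc k * a) + suc (suc k) * (suc n C suc (suc k))
    ≡⟨ cong₂ (λ x y → (a + x) + y) (absorption n k) (absorption n (suc k)) ⟩
  (a + suc n * (n C k)) + suc n * (n C suc k)
    ≡⟨ +-assoc a _ _ ⟩
  a + (suc n * (n C k) + suc n * (n C suc k))
    ≡⟨ cong (_+_ a) (*-distribˡ-+ (suc n) (n C k) _) ⟨
  a + suc n * ((n C k) + (n C suc k))
    ≡⟨ cong (λ x → a + suc n * x) (nCk+nC[k+1]≡[n+1]C[k+1] n k) ⟩
  suc (suc n) * a
    ∎
  where a = suc n C suc k

-- The ratio of neighbours in a row, with upper index `k + l` to avoid subtraction. Adding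
-- `suc k * b` completes Pascal's rule, and absorption applies.
C-ratio : ∀ l k → suc k * ((k + l) C suc k) ≡ l * ((k + l) C k)
C-ratio l k = +-cancelˡ-≡ (suc k * b) _ _ (begin
  suc k * b + suc k * ((k + l) C suc k)  ≡⟨ *-distribˡ-+ (suc k) b _ ⟨
  suc k * (b + ((k + l) C suc k))        ≡⟨ cong (suc k *_) (nCk+nC[k+1]≡[n+1]C[k+1] (k + l) k) ⟩
  suc k * (suc (k + l) C suc k)          ≡⟨ absorption (k + l) k ⟩
  suc (k + l) * b                        ≡⟨ *-distribʳ-+ b (suc k) l ⟩
  suc k * b + l * b                      ∎)
  where b = (k + l) C k

module _ (K : ℕ) where
  private k = suc K

  top : ℕ → ℕ → ℕ
  top r m = K + (k * m + r)

  -- Since top r m = k(m+1) + r - 1, this says that forests k r (m+1) is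
  -- r/(k(m+1)+r) · binom(k(m+1)+r, m+1), written as a difference of two binomials.
  forests-C : ∀ m r → forests k r (suc m) + K * (top r m C m) ≡ top r m C suc m
  -- Without trees the count is 0, and the binomials balance by `C-ratio`, the upper index being
  -- `m + suc m * K`.
  forests-C m zero = *-cancelˡ-≡ _ _ (suc m) (begin
    suc m * (K * (top 0 m C m))                         ≡⟨ *-assoc (suc m) K _ ⟨
    suc m * K * (top 0 m C m)                           ≡⟨ cong (λ t → suc m * K * (t C m)) (top₀ m) ⟩
    suc m * K * ((m + suc m * K) C m)                   ≡⟨ C-ratio (suc m * K) m ⟨
    suc m * ((m + suc m * K) C suc m)                   ≡⟨ cong (λ t → suc m * (t C suc m)) (top₀ m) ⟨
    suc m * (top 0 m C suc m)                           ∎)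
    where
    top₀ : ∀ m → top 0 m ≡ m + suc m * K
    top₀ m = arith K m
      where
      arith : ∀ K m → K + (suc K * m + 0) ≡ m + suc m * K
      arith = solve-∀
  forests-C m (suc r) = begin
    (forests k r (suc m) + forests k (k + r) m) + K * (top (suc r) m C m)
      ≡⟨ cong (λ t → (forests k r (suc m) + forests k (k + r) m) + K * (t C m)) topₛ ⟩
    (forests k r (suc m) + forests k (k + r) m) + K * (suc M C m)
      ≡⟨ pascalStep m refl ⟩
    suc M C suc m
      ≡⟨ cong (_C suc m) topₛ ⟨
    top (suc r) m C suc m
      ∎
    where
    M = top r m
    topₛ : top (suc r) m ≡ suc M
    topₛ = trans (cong (_+_ K) (+-suc (k * m) r)) (+-suc K (k * m + r))

    rearrange₀ : ∀ f c → (f + 1) + c ≡ 1 + (f + c)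
    rearrange₀ = solve-∀
    rearrange : ∀ K f g a b → (f + g) + K * (a + b) ≡ (g + K * a) + (f + K * b)
    rearrange = solve-∀
    top-shift : ∀ K r m → K + (suc K * m + (suc K + r)) ≡ K + (suc K * suc m + r)
    top-shift = solve-∀

    -- Pascal's rule on both binomials splits the claim into the cases `(m , r)` and
    -- `(m - 1 , k + r)`; for `m = 0` the latter contributes just 1.
    pascalStep : ∀ m′ → m′ ≡ m →
      (forests k r (suc m) + forests k (k + r) m′) + K * (suc M C m′) ≡ suc M C suc m′
    pascalStep zero refl = begin
      (forests k r 1 + 1) + K * 1       ≡⟨ rearrange₀ (forests k r 1) (K * 1) ⟩
      1 + (forests k r 1 + K * (M C 0)) ≡⟨ cong (_+_ 1) (forests-C 0 r) ⟩
      (M C 0) + (M C 1)                 ≡⟨ nCk+nC[k+1]≡[n+1]C[k+1] M 0 ⟩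
      suc M C 1                         ∎
    pascalStep (suc m″) refl = begin
      (f + g) + K * (suc M C m)              ≡⟨ cong (λ x → (f + g) + K * x) (nCk+nC[k+1]≡[n+1]C[k+1] M m″) ⟨
      (f + g) + K * ((M C m″) + (M C m))     ≡⟨ rearrange K f g (M C m″) (M C m) ⟩
      (g + K * (M C m″)) + (f + K * (M C m)) ≡⟨ cong₂ _+_ previous (forests-C m r) ⟩
      (M C m) + (M C suc m)                  ≡⟨ nCk+nC[k+1]≡[n+1]C[k+1] M m ⟩
      suc M C suc m                          ∎
      where
      f = forests k r (suc m)
      g = forests k (k + r) m
      previous : g + K * (M C m″) ≡ M C m
      -- Trading one internal vertex for `k` more trees leaves the upper index unchanged.
      previous = subst (λ t → g + K * (t C m″) ≡ t C m) (top-shift K r m″) (forests-C m″ (k + r))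

  -- The case `r = k` of `forests-C`, with the denominator cleared. `C-ratio` turns `L * a` into
  -- `suc m * b`, and `L` exceeds `K * suc m` by exactly `k`, so `f * L` is `k * b`; absorption
  -- gives the same for the binomial.
  forests-fussCatalan : ∀ m → forests k k m * suc (K * suc m) ≡ (k * suc m) C suc m
  forests-fussCatalan zero = begin
    1 * suc (K * 1)  ≡⟨ *-identityˡ _ ⟩
    suc (K * 1)      ≡⟨ cong suc (*-identityʳ K) ⟩
    k                ≡⟨ nC1≡n k ⟨
    k C 1            ≡⟨ cong (_C 1) (*-identityʳ k) ⟨
    (k * 1) C 1      ∎
  forests-fussCatalan (suc m) = trans scaled (sym binomial)
    where
    L = suc (K * suc (suc m))
    M = m + L
    a = M C m
    b = M C suc m
    f = forests k k (suc m)

    top-eq : ∀ K m → K + (suc K * m + suc K) ≡ m + suc (K * suc (suc m))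
    top-eq = solve-∀
    suc-M : ∀ K m → suc (m + suc (K * suc (suc m))) ≡ suc K * suc (suc m)
    suc-M = solve-∀

    f+Ka≡b : f + K * a ≡ b
    f+Ka≡b = subst (λ t → f + K * (t C m) ≡ t C suc m) (top-eq K m) (forests-C m k)

    regroup : ∀ K f a L → f * L + K * (L * a) ≡ (f + K * a) * L
    regroup = solve-∀
    split-off : ∀ K m b → b * suc (K * suc (suc m)) ≡ suc K * b + K * (suc m * b)
    split-off = solve-∀

    scaled : f * L ≡ k * b
    scaled = +-cancelʳ-≡ (K * (suc m * b)) _ _ (begin
      f * L + K * (suc m * b)  ≡⟨ cong (λ x → f * L + K * x) (C-ratio L m) ⟩
      f * L + K * (L * a)      ≡⟨ regroup K f a L ⟩
      (f + K * a) * L          ≡⟨ cong (_* L) f+Ka≡b ⟩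
      b * L                    ≡⟨ split-off K m b ⟩
      k * b + K * (suc m * b)  ∎)

    exchange : ∀ K m b → suc K * suc (suc m) * b ≡ suc (suc m) * (suc K * b)
    exchange = solve-∀

    binomial : (k * suc (suc m)) C suc (suc m) ≡ k * b
    binomial = *-cancelˡ-≡ _ _ (suc (suc m)) (begin
      suc (suc m) * ((k * suc (suc m)) C suc (suc m)) ≡⟨ cong (λ t → suc (suc m) * (t C suc (suc m))) (suc-M K m) ⟨
      suc (suc m) * (suc M C suc (suc m))             ≡⟨ absorption M (suc m) ⟩
      suc M * b                                       ≡⟨ cong (_* b) (suc-M K m) ⟩
      k * suc (suc m) * b                             ≡⟨ exchange K m b ⟩
      suc (suc m) * (k * b)                           ∎)

  -- Passing to unnormalised rationals makes the equality a cross-multiplication.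
  forests≡fussCatalan : ∀ m → + forests k k m / 1 ≡ fussCatalan k (suc m)
  forests≡fussCatalan m = ℚ.toℚᵘ-injective (ℚᵘ.≃-trans (ℚ.toℚᵘ-fromℚᵘ p) (ℚᵘ.≃-trans p≃q*r (ℚᵘ.≃-sym
    (ℚᵘ.≃-trans (ℚ.toℚᵘ-homo-* (ℚ.fromℚᵘ q) (ℚ.fromℚᵘ r))
      (ℚᵘ.*-cong (ℚ.toℚᵘ-fromℚᵘ q) (ℚ.toℚᵘ-fromℚᵘ r))))))
    where
    c = forests k k m
    b = (k * suc m) C suc m
    p = ℚᵘ.mkℚᵘ (+ c) 0
    q = ℚᵘ.mkℚᵘ (+ 1) (K * suc m)
    r = ℚᵘ.mkℚᵘ (+ b) 0
    p≃q*r : p ℚᵘ.≃ q ℚᵘ.* r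
    p≃q*r = ℚᵘ.*≡* (begin
      + c ℤ.* + (suc (K * suc m) * 1)  ≡⟨ cong (λ x → + c ℤ.* + x) (*-identityʳ (suc (K * suc m))) ⟩
      + c ℤ.* + suc (K * suc m)        ≡⟨ ℤ.pos-* c _ ⟨
      + (c * suc (K * suc m))          ≡⟨ cong +_ (forests-fussCatalan m) ⟩
      + b                              ≡⟨ ℤ.*-identityˡ (+ b) ⟨
      + 1 ℤ.* + b                      ≡⟨ ℤ.*-identityʳ _ ⟨
      (+ 1 ℤ.* + b) ℤ.* + 1            ∎)

-- Each class is numbered by `Fin (forests k k m)`, and so are the trees once the root is removed;
-- composing the numberings gives the bijections. Both list their options by increasing `d`, so the
-- site chosen at a descent is the number of trees to the right of the next internal vertex.
theorem3p5 : (k m s : ℕ) → .{{_ : NonTrivial k}} → 1 ≤ s → s ≤ k →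
    Inverse (𝒟 (m * k + s) k pattern213) (Trees k (suc m)) ×
    Inverse (𝒟 (m * k + s) k pattern312) (Trees k (suc m)) ×
    (Σ[ c ∈ ℕ ]
    HasCardinality (𝒟 (m * k + s) k pattern213) c ×
    HasCardinality (𝒟 (m * k + s) k pattern312) c ×
    (+ c / 1) ≡ fussCatalan k (suc m))
theorem3p5 zero    m s {{()}}
theorem3p5 (suc K) m s 1≤s s≤k =
  toTrees pattern213 213↔Fin , toTrees pattern312 312↔Fin ,
  forests k k m , 213↔Fin , 312↔Fin , forests≡fussCatalan K m
  where
  k = suc K
  N = m * k + s

  hasCardinality : ∀ p R → Matches p R → ShiftInvariant R →
                   {site : Sites (isMultiple k)} → Generates (isMultiple k) R site →
                   HasCardinality (𝒟 N k p) (forests k k m)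
  hasCardinality p R match shiftInvariant G = Composition.inverse
    (𝒟↔codes k {p} {R} match shiftInvariant G N)
    (subst (λ c → Inverse (setoid (Codes k N)) (setoid (Fin c)))
      (count≡forests K m 1≤s s≤k) (code↔Fin (isMultiple k) N))

  213↔Fin = hasCardinality pattern213 R213 matches213 R213-shift generates213
  312↔Fin = hasCardinality pattern312 R312 matches312 R312-shift generates312

  toTrees : ∀ (p : Permutation′ 3) → HasCardinality (𝒟 N k p) (forests k k m) →
            Inverse (𝒟 N k p) (Trees k (suc m))
  toTrees p 𝒟↔Fin = Composition.inverse 𝒟↔Fin
    (Symmetry.inverse (Composition.inverse (trees↔forest m) (forest↔Fin m k)))
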